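{- Let $X$ be a set (finite or infinite), let $M=X^*$ be the free monoid on $X$, let $k$ be a semiring and let $f\in k^M$ be a function $M\to k$. The following are equivalent: (i) the family $(f_w)_{w\in M}$ of right shifts of $f$ is contained in a finitely generated shift-invariant left submodule of $k^M$; (ii) the family $({}_wf)_{w\in M}$ of left shifts of $f$ is contained in a finitely generated shift-invariant right submodule of $k^M$; (iii) there exist an integer $n$, a row $\lambda\in k^{1\times n}$, a column $\gamma\in k^{n\times 1}$ and a morphism of monoids $\mu: M\to (k^{n\times n},\times)$ such that $f(w)=\lambda\mu(w)\gamma$ for all $w\in M$; (iv) $f$ lies in the rational closure of $\overline{kX}=\{\sum_{x\in X}\alpha(x)x\;:\;\alpha\in k^X\}$, i.e. in the smallest subalgebra of $k\langle\langle X\rangle\rangle$ which is closed under the star operation and contains $\overline{kX}$.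
   Context: A semiring $(k,+,\times)$ is a set with two laws such that $(k,+)$ is a commutative monoid with neutral $0_k$, $(k,\times)$ is a monoid (not necessarily commutative) with neutral $1_k$, $\times$ distributes over $+$ on both sides, and $0_k x=x0_k=0_k$ for all $x\in k$. A (left, right) $k$-module is a commutative monoid $(N,+)$ with a morphism of semirings from $k$ to $\mathrm{End}(N)$ (respectively to its opposite). The set $k^M$ of all functions $M\to k$ is a $k$-$k$-bimodule for pointwise addition and $(\alpha g)(x)=\alpha\, g(x)$, $(g\alpha)(x)=g(x)\alpha$. The free monoid $X^*$ is the set of finite words over $X$ with concatenation; its unit is the empty word $1_{X^*}$. Shifts: for $f: M\to k$ and $a\in M$, the right shift is $f_a: x\mapsto f(ax)$ and the left shift is ${}_af: x\mapsto f(xa)$. In (i), "shift-invariant" means stable under all right shifts $g\mapsto g_a$, $a\in M$; in (ii) it means stable under all left shifts $g\mapsto {}_ag$, $a\in M$. $k\langle\langle X\rangle\rangle$ denotes $k^{X^*}$ (noncommutative formal series), a function $f$ being written $\sum_{w} f(w)w$, with the convolution (Cauchy) product $(fg)(w)=\sum_{uv=w}f(u)g(v)$, whose unit is the characteristic function of $1_{X^*}$. A subalgebra is a subset closed under addition, product, left and right scalings by $k$, and containing zero and the unit. The element $\sum_{x\in X}\alpha(x)x$ is the series with value $\alpha(x)$ at each letter $x$ and $0_k$ at all other words. Star: a family of functions $(f_i)_{i\in I}$ from $M$ to $k$ is summable if for each $m\in M$ the family $(f_i(m))_{i\in I}$ is finitely supported; its sum is $m\mapsto\sum_i f_i(m)$.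 If $f(1_{X^*})=0_k$ then $(f^n)_{n\in\mathbb N}$ (convolution powers) is summable and $f^*:=\sum_{n\in\mathbb N}f^n$. A subset is closed under the star operation if it contains $f^*$ for each of its elements $f$ with $f(1_{X^*})=0_k$. -}

module Defs where

open import Algebra.Bundles using (Semiring)
open import Algebra.Bundles.Raw using (RawMonoid)
open import Algebra.Morphism.Structures using (module MonoidMorphisms)
import Algebra.Properties.Semiring.Sum as SemiringSum
open import Data.Bool.Base using (if_then_else_)
open import Data.Fin.Base using (Fin; zero; suc; toℕ)
open import Data.Fin.Properties using (_≟_)
open import Data.List.Base
  using (List; []; _∷_; _++_; length; take; drop; foldr; map; upTo; ++-[]-rawMonoid)
open import Data.List.Membership.Propositional using () renaming (_∉_ to _∉ˡ_)
open import Data.List.Membership.Propositional.Properties using (∈-upTo⁺)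
open import Data.List.Properties using (length-drop)
open import Data.List.Relation.Unary.Unique.Propositional using (Unique)
open import Data.List.Relation.Unary.Unique.Propositional.Properties using (upTo⁺)
open import Data.Nat.Base using (ℕ; zero; suc; _<_; s≤s)
open import Data.Nat.Properties using (≤-trans; ≤-<-trans; ≤-reflexive; m∸n≤m; ≮⇒≥)
open import Data.Product.Base using (Σ-syntax; _×_)
open import Data.Vec.Functional using (Vector)
open import Level using (Level; _⊔_) renaming (suc to lsuc)
open import Relation.Nullary.Decidable.Core using (does)
open import Relation.Unary using (Pred; _∈_; _⊆_; _≐_)

module FormalSeries {c ℓ x : Level} (K : Semiring c ℓ) (X : Set x) where

  open Semiring K
    using (Carrier; _≈_; 0#; 1#)
    renaming (_+_ to _+ᴷ_; _*_ to _*ᴷ_)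
  private module K = Semiring K
  open SemiringSum K using (sum)

  Word : Set x
  Word = List X

  Series : Set (c ⊔ x)
  Series = Word → Carrier

  infix 4 _≋_
  _≋_ : Series → Series → Set (ℓ ⊔ x)
  f ≋ g = ∀ w → f w ≈ g w

  infixl 6 _+_
  infixl 7 _*_ _*ₗ_ _*ᵣ_

  0ˢ : Series
  0ˢ _ = 0#

  _+_ : Series → Series → Series
  (f + g) w = f w +ᴷ g w

  _*ₗ_ : Carrier → Series → Series
  (α *ₗ g) w = α *ᴷ g w

  _*ᵣ_ : Series → Carrier → Series
  (g *ᵣ α) w = g w *ᴷ α

  rightShift : Word → Series → Series
  rightShift a f w = f (a ++ w)

  leftShift : Word → Series → Series
  leftShift a f w = f (w ++ a)

  -- A subset of k^M is a predicate on functions that respects pointwise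
  -- equality in the setoid of scalars (the `resp` fields below).

  record IsLeftSubmodule {p} (N : Pred Series p) : Set (c ⊔ ℓ ⊔ x ⊔ p) where
    field
      resp      : ∀ {f g} → f ≋ g → f ∈ N → g ∈ N
      0∈        : 0ˢ ∈ N
      +-closed  : ∀ {f g} → f ∈ N → g ∈ N → (f + g) ∈ N
      *ₗ-closed : ∀ α {f} → f ∈ N → (α *ₗ f) ∈ N

  record IsRightSubmodule {p} (N : Pred Series p) : Set (c ⊔ ℓ ⊔ x ⊔ p) where
    field
      resp      : ∀ {f g} → f ≋ g → f ∈ N → g ∈ N
      0∈        : 0ˢ ∈ N
      +-closed  : ∀ {f g} → f ∈ N → g ∈ N → (f + g) ∈ N
      *ᵣ-closed : ∀ α {f} → f ∈ N → (f *ᵣ α) ∈ N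

  LeftSpan : ∀ {n} → Vector Series n → Pred Series (c ⊔ ℓ ⊔ x)
  LeftSpan {n} g h =
    Σ[ α ∈ Vector Carrier n ] h ≋ (λ w → sum (λ i → (α i *ₗ g i) w))

  RightSpan : ∀ {n} → Vector Series n → Pred Series (c ⊔ ℓ ⊔ x)
  RightSpan {n} g h =
    Σ[ α ∈ Vector Carrier n ] h ≋ (λ w → sum (λ i → (g i *ᵣ α i) w))

  FinitelyGeneratedₗ : ∀ {p} → Pred Series p → Set (c ⊔ ℓ ⊔ x ⊔ p)
  FinitelyGeneratedₗ N = Σ[ n ∈ ℕ ] Σ[ g ∈ Vector Series n ] (N ≐ LeftSpan g)

  FinitelyGeneratedᵣ : ∀ {p} → Pred Series p → Set (c ⊔ ℓ ⊔ x ⊔ p)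
  FinitelyGeneratedᵣ N = Σ[ n ∈ ℕ ] Σ[ g ∈ Vector Series n ] (N ≐ RightSpan g)

  -- The level at which N is quantified is no restriction: it is that of
  -- `LeftSpan g`, and N must be extensionally equal to such a span.
  RightShiftsInFGLeftSubmodule : Series → Set (lsuc (c ⊔ ℓ ⊔ x))
  RightShiftsInFGLeftSubmodule f =
    Σ[ N ∈ Pred Series (c ⊔ ℓ ⊔ x) ]
      IsLeftSubmodule N
      × FinitelyGeneratedₗ N
      × (∀ a {g} → g ∈ N → rightShift a g ∈ N)
      × (∀ w → rightShift w f ∈ N)

  LeftShiftsInFGRightSubmodule : Series → Set (lsuc (c ⊔ ℓ ⊔ x))
  LeftShiftsInFGRightSubmodule f =
    Σ[ N ∈ Pred Series (c ⊔ ℓ ⊔ x) ]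
      IsRightSubmodule N
      × FinitelyGeneratedᵣ N
      × (∀ a {g} → g ∈ N → leftShift a g ∈ N)
      × (∀ w → leftShift w f ∈ N)

  Matrix : ℕ → ℕ → Set c
  Matrix m n = Fin m → Fin n → Carrier

  infixl 7 _⊗_
  _⊗_ : ∀ {m n p} → Matrix m n → Matrix n p → Matrix m p
  (A ⊗ B) i j = sum (λ l → A i l *ᴷ B l j)

  𝟙 : ∀ n → Matrix n n
  𝟙 n i j = if does (i ≟ j) then 1# else 0#

  matrixRawMonoid : ℕ → RawMonoid c ℓ
  matrixRawMonoid n = record
    { Carrier = Matrix n n
    ; _≈_     = λ A B → ∀ i j → A i j ≈ B i j
    ; _∙_     = _⊗_
    ; ε       = 𝟙 n
    }

  -- The 1×1 product row·μ(w)·col is identified with its only entry.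
  HasLinearRepresentation : Series → Set (c ⊔ ℓ ⊔ x)
  HasLinearRepresentation f =
    Σ[ n ∈ ℕ ] Σ[ row ∈ Matrix 1 n ] Σ[ col ∈ Matrix n 1 ] Σ[ μ ∈ (Word → Matrix n n) ]
      MonoidMorphisms.IsMonoidHomomorphism (++-[]-rawMonoid X) (matrixRawMonoid n) μ
      × (∀ w → f w ≈ (row ⊗ μ w ⊗ col) zero zero)

  1ˢ : Series
  1ˢ []      = 1#
  1ˢ (_ ∷ _) = 0#

  -- The factorisations uv = w are the pairs (take i w , drop i w), 0 ≤ i ≤ |w|.
  _*_ : Series → Series → Series
  (f * g) w = sum {suc (length w)} (λ i → f (take (toℕ i) w) *ᴷ g (drop (toℕ i) w))

  infixr 8 _^_
  _^_ : Series → ℕ → Series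
  f ^ zero  = 1ˢ
  f ^ suc n = f * f ^ n

  -- The finite support is carried as data; the listed indices may include some
  -- at which the family vanishes.
  record FinitelySupported {i} {I : Set i} (a : I → Carrier) : Set (i ⊔ ℓ) where
    field
      support : List I
      unique  : Unique support
      outside : ∀ {j} → j ∉ˡ support → a j ≈ 0#

    total : Carrier
    total = foldr _+ᴷ_ 0# (map a support)

  Summable : ∀ {i} {I : Set i} → (I → Series) → Set (i ⊔ ℓ ⊔ x)
  Summable F = ∀ w → FinitelySupported (λ j → F j w)

  sumFamily : ∀ {i} {I : Set i} (F : I → Series) → Summable F → Series
  sumFamily F s w = FinitelySupported.total (s w)

  private
    sum-zero : ∀ {n} (t : Vector Carrier n) → (∀ i → t i ≈ 0#) → sum t ≈ 0#
    sum-zero {zero}  t t≈0 = K.refl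
    sum-zero {suc n} t t≈0 =
      K.trans (K.+-cong (t≈0 zero) (sum-zero (λ i → t (suc i)) (λ i → t≈0 (suc i))))
              (K.+-identityˡ 0#)

  ^-vanishes : ∀ {f} → f [] ≈ 0# → ∀ n w → length w < n → (f ^ n) w ≈ 0#
  ^-vanishes {f} f₀ (suc n) w |w|<1+n = sum-zero _ (term w |w|<1+n)
    where
    term : ∀ w → length w < suc n → (i : Fin (suc (length w))) →
           f (take (toℕ i) w) *ᴷ (f ^ n) (drop (toℕ i) w) ≈ 0#
    term w       _         zero    = K.trans (K.*-congʳ f₀) (K.zeroˡ _)
    term (_ ∷ w) (s≤s w<n) (suc i) =
      K.trans (K.*-congˡ (^-vanishes f₀ n (drop (toℕ i) w) drop<n)) (K.zeroʳ _)
      where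
      drop<n : length (drop (toℕ i) w) < n
      drop<n = ≤-<-trans
        (≤-trans (≤-reflexive (length-drop (toℕ i) w)) (m∸n≤m (length w) (toℕ i))) w<n

  ^-summable : ∀ {f} → f [] ≈ 0# → Summable (f ^_)
  ^-summable f₀ w = record
    { support = upTo (suc (length w))
    ; unique  = upTo⁺ (suc (length w))
    ; outside = λ {n} n∉ → ^-vanishes f₀ n w (≮⇒≥ (λ n<1+|w| → n∉ (∈-upTo⁺ n<1+|w|)))
    }

  star : (f : Series) → f [] ≈ 0# → Series
  star f f₀ = sumFamily (f ^_) (^-summable f₀)

  record IsSubalgebra {p} (S : Pred Series p) : Set (c ⊔ ℓ ⊔ x ⊔ p) where
    field
      resp      : ∀ {f g} → f ≋ g → f ∈ S → g ∈ S
      0∈        : 0ˢ ∈ S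
      1∈        : 1ˢ ∈ S
      +-closed  : ∀ {f g} → f ∈ S → g ∈ S → (f + g) ∈ S
      *-closed  : ∀ {f g} → f ∈ S → g ∈ S → (f * g) ∈ S
      *ₗ-closed : ∀ α {f} → f ∈ S → (α *ₗ f) ∈ S
      *ᵣ-closed : ∀ α {f} → f ∈ S → (f *ᵣ α) ∈ S

  StarClosed : ∀ {p} → Pred Series p → Set (c ⊔ ℓ ⊔ x ⊔ p)
  StarClosed S = ∀ {f} → f ∈ S → (f₀ : f [] ≈ 0#) → star f f₀ ∈ S

  data RationalClosure {p} (G : Pred Series p) : Pred Series (c ⊔ ℓ ⊔ x ⊔ p) where
    gen   : ∀ {f} → f ∈ G → RationalClosure G f
    resp  : ∀ {f g} → f ≋ g → RationalClosure G f → RationalClosure G g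
    zeroᴿ : RationalClosure G 0ˢ
    oneᴿ  : RationalClosure G 1ˢ
    add   : ∀ {f g} → RationalClosure G f → RationalClosure G g → RationalClosure G (f + g)
    mul   : ∀ {f g} → RationalClosure G f → RationalClosure G g → RationalClosure G (f * g)
    scaleₗ : ∀ α {f} → RationalClosure G f → RationalClosure G (α *ₗ f)
    scaleᵣ : ∀ α {f} → RationalClosure G f → RationalClosure G (f *ᵣ α)
    starᴿ : ∀ {f} → RationalClosure G f → (f₀ : f [] ≈ 0#) → RationalClosure G (star f f₀)

  module _ {p} {G : Pred Series p} where

    RationalClosure-isSubalgebra : IsSubalgebra (RationalClosure G)
    RationalClosure-isSubalgebra = record
      { resp = resp ; 0∈ = zeroᴿ ; 1∈ = oneᴿ ; +-closed = add ; *-closed = mul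
      ; *ₗ-closed = scaleₗ ; *ᵣ-closed = scaleᵣ }

    RationalClosure-starClosed : StarClosed (RationalClosure G)
    RationalClosure-starClosed = starᴿ

    RationalClosure-least : ∀ {q} {S : Pred Series q} →
      IsSubalgebra S → StarClosed S → G ⊆ S → RationalClosure G ⊆ S
    RationalClosure-least {S = S} alg st G⊆S = go
      where
      module S = IsSubalgebra alg
      go : RationalClosure G ⊆ S
      go (gen f∈G)    = G⊆S f∈G
      go (resp f≋g r) = S.resp f≋g (go r)
      go zeroᴿ        = S.0∈
      go oneᴿ         = S.1∈
      go (add r s)    = S.+-closed (go r) (go s)
      go (mul r s)    = S.*-closed (go r) (go s)
      go (scaleₗ α r) = S.*ₗ-closed α (go r)
      go (scaleᵣ α r) = S.*ᵣ-closed α (go r)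
      go (starᴿ r f₀) = st (go r) f₀

  -- Infinite sums over letters need no summation: α(x) at x, 0 off the letters.
  letterSeries : (X → Carrier) → Series
  letterSeries α []          = 0#
  letterSeries α (a ∷ [])    = α a
  letterSeries α (_ ∷ _ ∷ _) = 0#

  kX : Pred Series (c ⊔ ℓ ⊔ x)
  kX f = Σ[ α ∈ (X → Carrier) ] f ≋ letterSeries α

{-# OPTIONS --safe #-}

-- A finitely generated shift-invariant left submodule containing f amounts to a
-- finite family g with f ∈ LeftSpan g and gᵢ(xw) = Σⱼ A(x)ᵢⱼ gⱼ(w).  Iterating these
-- relations gives gᵢ(w) = (μ(w)γ)ᵢ with γⱼ = gⱼ(1), a linear representation, and
-- dually on the other side.  The same relations read
-- gᵢ = Σⱼ (Σₓ A(x)ᵢⱼ x) gⱼ + gᵢ(1), a proper linear system, which Gaussian elimination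
-- solves by rational operations: the only solution of g = pg + r with p proper
-- is p*r (Arden).  Conversely x⁻¹(fg) = f(1)·x⁻¹g + (x⁻¹f)g, together with
-- x⁻¹(f*) = (x⁻¹f)f* for proper f, shows that such families are available for sums,
-- products and stars.
module Submission where

open import Defs
open import Algebra.Bundles using (CommutativeMonoid; Semiring)
import Algebra.Construct.Pointwise as Pointwise
open import Algebra.Morphism.Structures using (module MonoidMorphisms)
import Algebra.Properties.Semiring.Sum as SemiringSum
import Algebra.Solver.CommutativeMonoid as CommutativeMonoidSolver
open import Data.Fin.Base using (Fin; zero; suc; toℕ; _↑ˡ_; _↑ʳ_)
open import Data.List.Base
  using (List; []; _∷_; _++_; length; take; drop; foldr; map; upTo; applyUpTo)
open import Data.List.Properties using (++-assoc; ++-identityʳ; length-drop; map-upTo)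
open import Data.Nat.Base using (ℕ; zero; suc; _≤_; _<_; z≤n; s≤s)
open import Data.Nat.Properties using (≤-refl; ≤-<-trans; ≤-reflexive; ≤-trans; m∸n≤m)
open import Data.Product.Base using (Σ-syntax; _×_; _,_; proj₁; proj₂)
open import Data.Vec.Functional as Vector using (Vector)
open import Data.Vec.Functional.Properties using (lookup-++ˡ; lookup-++ʳ)
import Data.Vec.Functional.Relation.Unary.All.Properties as All
open import Function.Base using (_∘_; id)
open import Function.Bundles using (_⇔_; mk⇔)
open import Function.Properties.Equivalence using () renaming (trans to ⇔-trans; sym to ⇔-sym)
open import Level using (_⊔_)
open import Relation.Binary.PropositionalEquality as ≡ using (_≡_)
import Relation.Binary.Reasoning.Setoid as SetoidReasoning
open import Relation.Unary using (Pred; _∈_; _⊆_)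

module _ {c ℓ x} (K : Semiring c ℓ) (X : Set x) where

  open FormalSeries K X
  private module K = Semiring K
  open K using (Carrier; _≈_; 0#; 1#) renaming (_+_ to _+ᴷ_; _*_ to _*ᴷ_)
  open SemiringSum K
    using (sum; sum-cong-≋; sum-replicate-zero; ∑-distrib-+; ∑-comm; *-distribˡ-sum; *-distribʳ-sum)
  private module ≈-Reasoning = SetoidReasoning K.setoid

  sum-zero : ∀ {n} {t : Vector Carrier n} → (∀ i → t i ≈ 0#) → sum t ≈ 0#
  sum-zero {n} t≈0 = K.trans (sum-cong-≋ {n} t≈0) (sum-replicate-zero n)

  zeroˡ-+ : ∀ {a b} d → a ≈ 0# → a *ᴷ d +ᴷ b ≈ b
  zeroˡ-+ d a≈0 = K.trans (K.+-congʳ (K.trans (K.*-congʳ a≈0) (K.zeroˡ d))) (K.+-identityˡ _)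

  -- Matrices

  infix 4 _≈ᴹ_
  _≈ᴹ_ : ∀ {m n} → Matrix m n → Matrix m n → Set ℓ
  A ≈ᴹ B = ∀ i j → A i j ≈ B i j

  ≈ᴹ-sym : ∀ {m n} {A B : Matrix m n} → A ≈ᴹ B → B ≈ᴹ A
  ≈ᴹ-sym A≈B i j = K.sym (A≈B i j)

  ≈ᴹ-trans : ∀ {m n} {A B C : Matrix m n} → A ≈ᴹ B → B ≈ᴹ C → A ≈ᴹ C
  ≈ᴹ-trans A≈B B≈C i j = K.trans (A≈B i j) (B≈C i j)

  ≈ᴹ-reflexive : ∀ {m n} {A B : Matrix m n} → A ≡ B → A ≈ᴹ B
  ≈ᴹ-reflexive ≡.refl i j = K.refl

  ⊗-congˡ : ∀ {m n p} (A : Matrix m n) {B C : Matrix n p} → B ≈ᴹ C → A ⊗ B ≈ᴹ A ⊗ C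
  ⊗-congˡ {n = n} A B≈C i j = sum-cong-≋ {n} λ l → K.*-congˡ (B≈C l j)

  ⊗-congʳ : ∀ {m n p} {A B : Matrix m n} (C : Matrix n p) → A ≈ᴹ B → A ⊗ C ≈ᴹ B ⊗ C
  ⊗-congʳ {n = n} C A≈B i j = sum-cong-≋ {n} λ l → K.*-congʳ (A≈B i l)

  ⊗-assoc : ∀ {m n p q} (A : Matrix m n) (B : Matrix n p) (C : Matrix p q) →
            (A ⊗ B) ⊗ C ≈ᴹ A ⊗ (B ⊗ C)
  ⊗-assoc {n = n} {p} A B C i j = let open ≈-Reasoning in begin
    sum (λ l → sum (λ k → A i k *ᴷ B k l) *ᴷ C l j)
      ≈⟨ sum-cong-≋ {p} (λ l → *-distribʳ-sum {n} (C l j) (λ k → A i k *ᴷ B k l)) ⟩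
    sum (λ l → sum (λ k → A i k *ᴷ B k l *ᴷ C l j))
      ≈⟨ ∑-comm {p} {n} (λ l k → A i k *ᴷ B k l *ᴷ C l j) ⟩
    sum (λ k → sum (λ l → A i k *ᴷ B k l *ᴷ C l j))
      ≈⟨ sum-cong-≋ {n} (λ k → sum-cong-≋ {p} λ l → K.*-assoc (A i k) (B k l) (C l j)) ⟩
    sum (λ k → sum (λ l → A i k *ᴷ (B k l *ᴷ C l j)))
      ≈⟨ sum-cong-≋ {n} (λ k → *-distribˡ-sum {p} (A i k) (λ l → B k l *ᴷ C l j)) ⟨
    sum (λ k → A i k *ᴷ sum (λ l → B k l *ᴷ C l j)) ∎

  ⊗-identityˡ : ∀ {m n} (A : Matrix m n) → 𝟙 m ⊗ A ≈ᴹ A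
  ⊗-identityˡ {suc m} A zero j = let open ≈-Reasoning in begin
    1# *ᴷ A zero j +ᴷ sum (λ l → 0# *ᴷ A (suc l) j)
      ≈⟨ K.+-cong (K.*-identityˡ _) (sum-zero {m} λ l → K.zeroˡ (A (suc l) j)) ⟩
    A zero j +ᴷ 0#
      ≈⟨ K.+-identityʳ _ ⟩
    A zero j ∎
  ⊗-identityˡ A (suc i) j = K.trans (zeroˡ-+ _ K.refl) (⊗-identityˡ (A ∘ suc) i j)

  ⊗-identityʳ : ∀ {m n} (A : Matrix m n) → A ⊗ 𝟙 n ≈ᴹ A
  ⊗-identityʳ {n = suc n} A i zero = let open ≈-Reasoning in begin
    A i zero *ᴷ 1# +ᴷ sum (λ l → A i (suc l) *ᴷ 0#)
      ≈⟨ K.+-cong (K.*-identityʳ _) (sum-zero {n} λ l → K.zeroʳ (A i (suc l))) ⟩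
    A i zero +ᴷ 0#
      ≈⟨ K.+-identityʳ _ ⟩
    A i zero ∎
  ⊗-identityʳ A i (suc j) = let open ≈-Reasoning in begin
    A i zero *ᴷ 0# +ᴷ (A′ ⊗ 𝟙 _) i j  ≈⟨ K.+-congʳ (K.zeroʳ _) ⟩
    0# +ᴷ (A′ ⊗ 𝟙 _) i j              ≈⟨ K.+-identityˡ _ ⟩
    (A′ ⊗ 𝟙 _) i j                    ≈⟨ ⊗-identityʳ A′ i j ⟩
    A i (suc j)                       ∎
    where
    A′ : Matrix _ _
    A′ i l = A i (suc l)

  -- The extension of a map on letters to a monoid morphism, given by the freeness of the word
  -- monoid.
  matrixProduct : ∀ {n} → (X → Matrix n n) → Word → Matrix n n
  matrixProduct A []      = 𝟙 _
  matrixProduct A (a ∷ w) = A a ⊗ matrixProduct A w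

  matrixProduct-++ : ∀ {n} (A : X → Matrix n n) u v →
    matrixProduct A (u ++ v) ≈ᴹ matrixProduct A u ⊗ matrixProduct A v
  matrixProduct-++ A []      v = ≈ᴹ-sym (⊗-identityˡ _)
  matrixProduct-++ A (a ∷ u) v =
    ≈ᴹ-trans (⊗-congˡ (A a) (matrixProduct-++ A u v)) (≈ᴹ-sym (⊗-assoc (A a) (matrixProduct A u) (matrixProduct A v)))

  linearRepresentation : ∀ {n f} (row : Matrix 1 n) (A : X → Matrix n n) (col : Matrix n 1) →
    (∀ w → f w ≈ (row ⊗ matrixProduct A w ⊗ col) zero zero) → HasLinearRepresentation f
  linearRepresentation row A col f≈ = _ , row , col , matrixProduct A ,
    record
      { isMagmaHomomorphism = record
        { isRelHomomorphism = record { cong = ≈ᴹ-reflexive ∘ ≡.cong (matrixProduct A) }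
        ; homo = matrixProduct-++ A
        }
      ; ε-homo = λ i j → K.refl
      } ,
    f≈

  -- Spans

  LeftSpan-isLeftSubmodule : ∀ {n} (g : Vector Series n) → IsLeftSubmodule (LeftSpan g)
  LeftSpan-isLeftSubmodule {n} g = record
    { resp      = λ f≋h (α , f≋) → α , λ w → K.trans (K.sym (f≋h w)) (f≋ w)
    ; 0∈        = (λ _ → 0#) , λ w → K.sym (sum-zero {n} λ i → K.zeroˡ (g i w))
    ; +-closed  = λ (α , f≋) (β , h≋) → (λ i → α i +ᴷ β i) , λ w →
        K.trans (K.+-cong (f≋ w) (h≋ w))
          (K.sym (K.trans (sum-cong-≋ {n} λ i → K.distribʳ (g i w) (α i) (β i)) (∑-distrib-+ {n} _ _)))
    ; *ₗ-closed = λ α (β , f≋) → (λ i → α *ᴷ β i) , λ w →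
        K.trans (K.*-congˡ (f≋ w))
          (K.trans (*-distribˡ-sum {n} α _) (sum-cong-≋ {n} λ i → K.sym (K.*-assoc α (β i) (g i w))))
    }

  RightSpan-isRightSubmodule : ∀ {n} (g : Vector Series n) → IsRightSubmodule (RightSpan g)
  RightSpan-isRightSubmodule {n} g = record
    { resp      = λ f≋h (α , f≋) → α , λ w → K.trans (K.sym (f≋h w)) (f≋ w)
    ; 0∈        = (λ _ → 0#) , λ w → K.sym (sum-zero {n} λ i → K.zeroʳ (g i w))
    ; +-closed  = λ (α , f≋) (β , h≋) → (λ i → α i +ᴷ β i) , λ w →
        K.trans (K.+-cong (f≋ w) (h≋ w))
          (K.sym (K.trans (sum-cong-≋ {n} λ i → K.distribˡ (g i w) (α i) (β i)) (∑-distrib-+ {n} _ _)))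
    ; *ᵣ-closed = λ α (β , f≋) → (λ i → β i *ᴷ α) , λ w →
        K.trans (K.*-congʳ (f≋ w))
          (K.trans (*-distribʳ-sum {n} α _) (sum-cong-≋ {n} λ i → K.*-assoc (g i w) (β i) α))
    }

  generator∈LeftSpan : ∀ {n} (g : Vector Series n) i → g i ∈ LeftSpan g
  -- For fixed `w` the values `g j w` form a column, and the claim is row `i` of the identity law
  -- for that column.
  generator∈LeftSpan g i = 𝟙 _ i , λ w → K.sym (⊗-identityˡ {n = 1} (λ j _ → g j w) i zero)

  generator∈RightSpan : ∀ {n} (g : Vector Series n) i → g i ∈ RightSpan g
  generator∈RightSpan g i =
    (λ j → 𝟙 _ j i) , λ w → K.sym (⊗-identityʳ {m = 1} (λ _ j → g j w) zero i)

  LeftSpan-least : ∀ {p} {N : Pred Series p} → IsLeftSubmodule N →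
    ∀ {n} {g : Vector Series n} → (∀ i → g i ∈ N) → LeftSpan g ⊆ N
  LeftSpan-least {N = N} sub g∈N (α , h≋) = N.resp (λ w → K.sym (h≋ w)) (combination _ α g∈N)
    where
    module N = IsLeftSubmodule sub
    combination : ∀ {n} (g : Vector Series n) (α : Vector Carrier n) → (∀ i → g i ∈ N) →
                  (λ w → sum (λ i → (α i *ₗ g i) w)) ∈ N
    combination {zero}  g α g∈N = N.0∈
    combination {suc n} g α g∈N =
      N.+-closed (N.*ₗ-closed (α zero) (g∈N zero)) (combination (g ∘ suc) (α ∘ suc) (g∈N ∘ suc))

  record IsLeftLinear (T : Series → Series) : Set (c ⊔ ℓ ⊔ x) where
    field
      cong    : ∀ {f g} → f ≋ g → T f ≋ T g
      0-homo  : T 0ˢ ≋ 0ˢ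
      +-homo  : ∀ f g → T (f + g) ≋ T f + T g
      *ₗ-homo : ∀ α f → T (α *ₗ f) ≋ α *ₗ T f

  -- The preimage of `N` under a left linear `T` is again a left submodule, so minimality of the
  -- span applies to it. Shifts, right multiplication by a series and right scaling are the
  -- instances of `T`.
  LeftSpan-map : ∀ {T} → IsLeftLinear T → ∀ {p} {N : Pred Series p} → IsLeftSubmodule N →
    ∀ {n} {g : Vector Series n} → (∀ i → T (g i) ∈ N) → ∀ {h} → h ∈ LeftSpan g → T h ∈ N
  LeftSpan-map {T} lin {N = N} sub Tg∈N = LeftSpan-least {N = N ∘ T} (record
    { resp      = λ f≋g → N.resp (T.cong f≋g)
    ; 0∈        = N.resp (≋-sym T.0-homo) N.0∈
    ; +-closed  = λ Tf∈N Tg∈N → N.resp (≋-sym (T.+-homo _ _)) (N.+-closed Tf∈N Tg∈N)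
    ; *ₗ-closed = λ α Tf∈N → N.resp (≋-sym (T.*ₗ-homo α _)) (N.*ₗ-closed α Tf∈N)
    }) Tg∈N
    where
    module N = IsLeftSubmodule sub
    module T = IsLeftLinear lin
    ≋-sym : ∀ {f g} → f ≋ g → g ≋ f
    ≋-sym f≋g w = K.sym (f≋g w)

  -- Shift-invariant submodules and linear representations

  ∂ : X → Series → Series
  ∂ a = rightShift (a ∷ [])

  ∂-Stable : ∀ {n} → Vector Series n → Set (c ⊔ ℓ ⊔ x)
  ∂-Stable g = ∀ a i → ∂ a (g i) ∈ LeftSpan g

  -- A working form of condition (i): the generators are explicit and stability is asked for letters
  -- only. The closure properties are proved for this form.
  Recognizable : Pred Series (c ⊔ ℓ ⊔ x)
  Recognizable f = Σ[ n ∈ ℕ ] Σ[ g ∈ Vector Series n ] ∂-Stable g × f ∈ LeftSpan g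

  rightShifts⇒recognizable : ∀ {f} → RightShiftsInFGLeftSubmodule f → Recognizable f
  rightShifts⇒recognizable (N , _ , (n , g , N⊆span , span⊆N) , shift , f∈N) =
    -- The shift of `f` by the empty word is `f` itself.
    n , g , (λ a i → N⊆span (shift (a ∷ []) (span⊆N (generator∈LeftSpan g i)))) , N⊆span (f∈N [])

  recognizable⇒representation : ∀ {f} → Recognizable f → HasLinearRepresentation f
  recognizable⇒representation {f} (n , g , stable , λᶠ , f≋) = linearRepresentation row A (G []) f≈
    where
    row : Matrix 1 n
    row _ = λᶠ
    A : X → Matrix n n
    A a i = proj₁ (stable a i)
    G : Word → Matrix n 1
    G w i _ = g i w
    G≈ : ∀ w → G w ≈ᴹ matrixProduct A w ⊗ G []
    G≈ []      = ≈ᴹ-sym (⊗-identityˡ (G []))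
    G≈ (a ∷ w) = ≈ᴹ-trans (λ i _ → proj₂ (stable a i) w)
      (≈ᴹ-trans (⊗-congˡ (A a) (G≈ w)) (≈ᴹ-sym (⊗-assoc (A a) (matrixProduct A w) (G []))))
    f≈ : ∀ w → f w ≈ (row ⊗ matrixProduct A w ⊗ G []) zero zero
    f≈ w = K.trans (f≋ w) (≈ᴹ-trans (⊗-congˡ row (G≈ w))
      (≈ᴹ-sym (⊗-assoc row (matrixProduct A w) (G []))) zero zero)

  leftShifts⇒representation : ∀ {f} → LeftShiftsInFGRightSubmodule f → HasLinearRepresentation f
  leftShifts⇒representation {f} (N , _ , (n , g , N⊆span , span⊆N) , shift , f∈N) =
    linearRepresentation (G []) A col f≈
    where
    stable : ∀ a j → leftShift (a ∷ []) (g j) ∈ RightSpan g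
    stable a j = N⊆span (shift (a ∷ []) (span⊆N (generator∈RightSpan g j)))
    f∈span : leftShift [] f ∈ RightSpan g
    f∈span = N⊆span (f∈N [])
    col : Matrix n 1
    col i _ = proj₁ f∈span i
    A : X → Matrix n n
    -- The indices are transposed relative to the left-module case: the right coefficients of the
    -- shift of `g j` form column `j`.
    A a i j = proj₁ (stable a j) i
    G : Word → Matrix 1 n
    G w _ j = g j w
    -- Left shifts append letters at the end while words are built at the front. The prefix `u`
    -- therefore accumulates the letters already read, and the induction is on `w`.
    G-++ : ∀ u w → G (u ++ w) ≈ᴹ G u ⊗ matrixProduct A w
    G-++ u []      = ≈ᴹ-trans (≈ᴹ-reflexive (≡.cong G (++-identityʳ u))) (≈ᴹ-sym (⊗-identityʳ (G u)))
    G-++ u (a ∷ w) = ≈ᴹ-trans (≈ᴹ-reflexive (≡.cong G (≡.sym (++-assoc u (a ∷ []) w))))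
      (≈ᴹ-trans (G-++ (u ++ a ∷ []) w)
      (≈ᴹ-trans (⊗-congʳ (matrixProduct A w) (λ _ j → proj₂ (stable a j) u))
                (⊗-assoc (G u) (A a) (matrixProduct A w))))
    f≈ : ∀ w → f w ≈ (G [] ⊗ matrixProduct A w ⊗ col) zero zero
    f≈ w = K.trans (K.reflexive (≡.cong f (≡.sym (++-identityʳ w))))
      (K.trans (proj₂ f∈span w) (⊗-congʳ col (G-++ [] w) zero zero))

  module _ {f : Series} (rep : HasLinearRepresentation f) where

    private
      n   = proj₁ rep
      row = proj₁ (proj₂ rep)
      col = proj₁ (proj₂ (proj₂ rep))
      μ   = proj₁ (proj₂ (proj₂ (proj₂ rep)))

      μ-++ : ∀ u v → μ (u ++ v) ≈ᴹ μ u ⊗ μ v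
      μ-++ = homo
        where
        open MonoidMorphisms.IsMonoidHomomorphism (proj₁ (proj₂ (proj₂ (proj₂ (proj₂ rep)))))

      f≈ : ∀ w → f w ≈ (row ⊗ μ w ⊗ col) zero zero
      f≈ = proj₂ (proj₂ (proj₂ (proj₂ (proj₂ rep))))

    -- The generators are the entries of the column `μ w ⊗ col`, as functions of `w`. Since `μ` is
    -- multiplicative, a shift by `a` only replaces a coefficient row `α` by `α μ(a)`. The series
    -- `f` has coefficient row `row`.
    representation⇒rightShifts : RightShiftsInFGLeftSubmodule f
    representation⇒rightShifts =
      LeftSpan g , LeftSpan-isLeftSubmodule g , (n , g , id , id) , shift ,
      λ w → shift w (row zero , λ v → K.trans (f≈ v) (⊗-assoc row (μ v) col zero zero))
      where
      G : Word → Matrix n 1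
      G w = μ w ⊗ col
      g : Vector Series n
      g i w = G w i zero
      shift : ∀ a {h} → h ∈ LeftSpan g → rightShift a h ∈ LeftSpan g
      shift a {h} (α , h≋) = (α′ ⊗ μ a) zero , λ w → K.trans (h≋ (a ++ w)) (≈ᴹ-trans
        (⊗-congˡ α′ (≈ᴹ-trans (⊗-congʳ col (μ-++ a w)) (⊗-assoc (μ a) (μ w) col)))
        (≈ᴹ-sym (⊗-assoc α′ (μ a) (G w))) zero zero)
        where
        α′ : Matrix 1 n
        α′ _ = α

    -- Dually, the generators are the entries of `row ⊗ μ w`, and a shift by `a` multiplies the
    -- coefficient column by `μ a` on the left.
    representation⇒leftShifts : LeftShiftsInFGRightSubmodule f
    representation⇒leftShifts =
      RightSpan g , RightSpan-isRightSubmodule g , (n , g , id , id) , shift ,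
      λ w → shift w ((λ i → col i zero) , f≈)
      where
      G : Word → Matrix 1 n
      G w = row ⊗ μ w
      g : Vector Series n
      g j w = G w zero j
      shift : ∀ a {h} → h ∈ RightSpan g → leftShift a h ∈ RightSpan g
      shift a {h} (α , h≋) = (λ i → (μ a ⊗ α′) i zero) , λ w → K.trans (h≋ (w ++ a)) (≈ᴹ-trans
        (⊗-congʳ α′ (≈ᴹ-trans (⊗-congˡ row (μ-++ w a)) (≈ᴹ-sym (⊗-assoc row (μ w) (μ a)))))
        (⊗-assoc (G w) (μ a) α′) zero zero)
        where
        α′ : Matrix n 1
        α′ i _ = α i

  -- The semiring of series

  -- Passed explicitly below: (f * g) w unfolds, so unification does not recover the summands.
  summand : Series → Series → (w : Word) → Vector Carrier (suc (length w))
  summand f g w i = f (take (toℕ i) w) *ᴷ g (drop (toℕ i) w)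

  *-cong : ∀ {f g h k} → f ≋ g → h ≋ k → f * h ≋ g * k
  *-cong {f} {g} {h} {k} f≋g h≋k w =
    sum-cong-≋ {_} {summand f h w} {summand g k w} λ i → K.*-cong (f≋g _) (h≋k _)

  *-distribˡ-+ : ∀ f g h → f * (g + h) ≋ f * g + f * h
  *-distribˡ-+ f g h w = K.trans
    (sum-cong-≋ {_} {summand f (g + h) w} λ i → K.distribˡ _ _ _)
    (∑-distrib-+ (summand f g w) (summand f h w))

  *-distribʳ-+ : ∀ f g h → (g + h) * f ≋ g * f + h * f
  *-distribʳ-+ f g h w = K.trans
    (sum-cong-≋ {_} {summand (g + h) f w} λ i → K.distribʳ _ _ _)
    (∑-distrib-+ (summand g f w) (summand h f w))

  *-zeroˡ : ∀ f → 0ˢ * f ≋ 0ˢ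
  *-zeroˡ f w = sum-zero {t = summand 0ˢ f w} λ i → K.zeroˡ _

  *-zeroʳ : ∀ f → f * 0ˢ ≋ 0ˢ
  *-zeroʳ f w = sum-zero {t = summand f 0ˢ w} λ i → K.zeroʳ _

  *ₗ-*-assoc : ∀ α f g → (α *ₗ f) * g ≋ α *ₗ (f * g)
  *ₗ-*-assoc α f g w = K.trans
    (sum-cong-≋ {_} {summand (α *ₗ f) g w} λ i → K.*-assoc α _ _)
    (K.sym (*-distribˡ-sum α (summand f g w)))

  *-identityˡ : ∀ f → 1ˢ * f ≋ f
  *-identityˡ f []      = K.trans (K.+-identityʳ _) (K.*-identityˡ _)
  *-identityˡ f (a ∷ w) =
    -- The derivative `∂ a 1ˢ` is `0ˢ` by computation, so the remaining summands are those of
    -- `0ˢ * f`.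
    K.trans (K.+-cong (K.*-identityˡ _) (*-zeroˡ f w)) (K.+-identityʳ _)

  *-identityʳ : ∀ f → f * 1ˢ ≋ f
  *-identityʳ f []      = K.trans (K.+-identityʳ _) (K.*-identityʳ _)
  *-identityʳ f (a ∷ w) =
    K.trans (K.+-cong (K.zeroʳ _) (*-identityʳ (∂ a f) w)) (K.+-identityˡ _)

  -- Both (f * g) (a ∷ w) and ∂ a (f * g) unfold by computation, since the summand of
  -- index suc i of f * g is the summand of index i of ∂ a f * g.
  *-assoc : ∀ f g h → (f * g) * h ≋ f * (g * h)
  *-assoc f g h [] = K.+-congʳ (let open ≈-Reasoning in begin
    (f [] *ᴷ g [] +ᴷ 0#) *ᴷ h []   ≈⟨ K.*-congʳ (K.+-identityʳ _) ⟩
    f [] *ᴷ g [] *ᴷ h []           ≈⟨ K.*-assoc _ _ _ ⟩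
    f [] *ᴷ (g [] *ᴷ h [])         ≈⟨ K.*-congˡ (K.+-identityʳ _) ⟨
    f [] *ᴷ (g [] *ᴷ h [] +ᴷ 0#)   ∎)
  *-assoc f g h (a ∷ w) = let open ≈-Reasoning in begin
    (f [] *ᴷ g [] +ᴷ 0#) *ᴷ h (a ∷ w) +ᴷ ((f [] *ₗ ∂ a g + ∂ a f * g) * h) w
      ≈⟨ K.+-cong (K.*-congʳ (K.+-identityʳ _)) (*-distribʳ-+ h (f [] *ₗ ∂ a g) (∂ a f * g) w) ⟩
    f [] *ᴷ g [] *ᴷ h (a ∷ w) +ᴷ (((f [] *ₗ ∂ a g) * h) w +ᴷ ((∂ a f * g) * h) w)
      ≈⟨ K.+-cong (K.*-assoc _ _ _) (K.+-cong (*ₗ-*-assoc (f []) (∂ a g) h w) (*-assoc (∂ a f) g h w)) ⟩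
    f [] *ᴷ (g [] *ᴷ h (a ∷ w)) +ᴷ (f [] *ᴷ (∂ a g * h) w +ᴷ (∂ a f * (g * h)) w)
      ≈⟨ K.+-assoc _ _ _ ⟨
    f [] *ᴷ (g [] *ᴷ h (a ∷ w)) +ᴷ f [] *ᴷ (∂ a g * h) w +ᴷ (∂ a f * (g * h)) w
      ≈⟨ K.+-congʳ (K.distribˡ _ _ _) ⟨
    f [] *ᴷ (g [] *ᴷ h (a ∷ w) +ᴷ (∂ a g * h) w) +ᴷ (∂ a f * (g * h)) w ∎

  seriesSemiring : Semiring (c ⊔ x) (ℓ ⊔ x)
  seriesSemiring = record
    { Carrier = Series
    ; _≈_ = _≋_
    ; _+_ = _+_
    ; _*_ = _*_
    ; 0# = 0ˢ
    ; 1# = 1ˢ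
    ; isSemiring = record
      { isSemiringWithoutAnnihilatingZero = record
        { +-isCommutativeMonoid = CommutativeMonoid.isCommutativeMonoid
            (Pointwise.commutativeMonoid Word K.+-commutativeMonoid)
        ; *-cong = *-cong
        ; *-assoc = *-assoc
        ; *-identity = *-identityˡ , *-identityʳ
        ; distrib = *-distribˡ-+ , *-distribʳ-+
        }
      ; zero = *-zeroˡ , *-zeroʳ
      }
    }

  private module S where
    open Semiring seriesSemiring public
    open SemiringSum seriesSemiring public
  private module ≋-Reasoning = SetoidReasoning S.setoid

  sumˢ-lookup : ∀ {n} (F : Vector Series n) w → S.sum F w ≡ sum (λ i → F i w)
  sumˢ-lookup {zero}  F w = ≡.refl
  sumˢ-lookup {suc n} F w = ≡.cong (F zero w +ᴷ_) (sumˢ-lookup (F ∘ suc) w)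

  *-isLeftLinear : ∀ g → IsLeftLinear (_* g)
  *-isLeftLinear g = record
    { cong    = λ f≋h → *-cong f≋h S.refl
    ; 0-homo  = *-zeroˡ g
    ; +-homo  = *-distribʳ-+ g
    ; *ₗ-homo = λ α f → *ₗ-*-assoc α f g
    }

  *ᵣ-isLeftLinear : ∀ α → IsLeftLinear (_*ᵣ α)
  *ᵣ-isLeftLinear α = record
    { cong    = λ f≋g w → K.*-congʳ (f≋g w)
    ; 0-homo  = λ w → K.zeroˡ α
    ; +-homo  = λ f g w → K.distribʳ α (f w) (g w)
    ; *ₗ-homo = λ β f w → K.*-assoc β (f w) α
    }

  -- Star and Arden's lemma

  infix 4 _≈[_]_
  -- Agreement to order `n`. It stands in for convergence in the topology given by word length.
  _≈[_]_ : Series → ℕ → Series → Set (ℓ ⊔ x)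
  f ≈[ n ] g = ∀ w → length w < n → f w ≈ g w

  *-congˡ-[] : ∀ f {g h n} → g ≈[ n ] h → f * g ≈[ n ] f * h
  *-congˡ-[] f {g} {h} g≈h w w<n = sum-cong-≋ {_} {summand f g w} {summand f h w} λ i →
    K.*-congˡ (g≈h (drop (toℕ i) w) (≤-<-trans (≤-trans (≤-reflexive (length-drop (toℕ i) w)) (m∸n≤m (length w) (toℕ i))) w<n))

  -- Multiplication by a proper series is contracting: the factorisation with empty left factor
  -- contributes zero, and in all others the right factor is strictly shorter than the word. One
  -- order of agreement is gained.
  proper-*-congˡ-[] : ∀ {f} → f [] ≈ 0# → ∀ {g h n} → g ≈[ n ] h → f * g ≈[ suc n ] f * h
  proper-*-congˡ-[] f₀ g≈h [] _ = K.trans (zeroˡ-+ _ f₀) (K.sym (zeroˡ-+ _ f₀))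
  proper-*-congˡ-[] {f} f₀ g≈h (a ∷ w) (s≤s w<n) = K.trans (zeroˡ-+ _ f₀)
    (K.trans (*-congˡ-[] (∂ a f) g≈h w w<n) (K.sym (zeroˡ-+ _ f₀)))

  sum-vanishing-tail : ∀ (a : ℕ → Carrier) {m n} → m ≤ n → (∀ k → m ≤ k → a k ≈ 0#) →
    sum {n} (a ∘ toℕ) ≈ sum {m} (a ∘ toℕ)
  sum-vanishing-tail a {n = n} z≤n a≈0 = sum-zero {n} λ i → a≈0 (toℕ i) z≤n
  sum-vanishing-tail a (s≤s m≤n)   a≈0 =
    K.+-congˡ (sum-vanishing-tail (a ∘ suc) m≤n λ k m≤k → a≈0 (suc k) (s≤s m≤k))

  foldr-applyUpTo : ∀ (a : ℕ → Carrier) n → foldr _+ᴷ_ 0# (applyUpTo a n) ≡ sum {n} (a ∘ toℕ)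
  foldr-applyUpTo a zero    = ≡.refl
  foldr-applyUpTo a (suc n) = ≡.cong (a 0 +ᴷ_) (foldr-applyUpTo (a ∘ suc) n)

  powerSum : Series → ℕ → Series
  powerSum f n = S.sum {n} (λ i → f ^ toℕ i)

  powerSum-suc : ∀ f n → powerSum f (suc n) ≋ 1ˢ + f * powerSum f n
  powerSum-suc f n = S.+-congˡ {1ˢ} (S.sym (S.*-distribˡ-sum {n} f (λ i → f ^ toℕ i)))

  -- The star is totalled over a range of exponents that depends on the word. Powers of a proper
  -- series vanish on words shorter than their exponent, so one bound `n` serves all words of length
  -- below `n`, and semiring laws become available.
  star≈powerSum : ∀ {f} (f₀ : f [] ≈ 0#) n → star f f₀ ≈[ n ] powerSum f n
  star≈powerSum {f} f₀ n w w<n = let open ≈-Reasoning in begin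
    foldr _+ᴷ_ 0# (map a (upTo (suc (length w))))
      ≡⟨ ≡.cong (foldr _+ᴷ_ 0#) (map-upTo a (suc (length w))) ⟩
    foldr _+ᴷ_ 0# (applyUpTo a (suc (length w)))
      ≡⟨ foldr-applyUpTo a (suc (length w)) ⟩
    sum {suc (length w)} (a ∘ toℕ)
      ≈⟨ sum-vanishing-tail a w<n (λ k → ^-vanishes f₀ k w) ⟨
    sum {n} (a ∘ toℕ)
      ≡⟨ sumˢ-lookup {n} (λ i → f ^ toℕ i) w ⟨
    powerSum f n w ∎
    where
    a : ℕ → Carrier
    a k = (f ^ k) w

  star-unfold : ∀ {f} (f₀ : f [] ≈ 0#) → star f f₀ ≋ 1ˢ + f * star f f₀
  star-unfold {f} f₀ w = let open ≈-Reasoning in begin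
    star f f₀ w
      ≈⟨ star≈powerSum f₀ (suc n) w ≤-refl ⟩
    powerSum f (suc n) w
      ≈⟨ powerSum-suc f n w ⟩
    1ˢ w +ᴷ (f * powerSum f n) w
      -- Order `n` inside the product is enough for a word of length `n`, because multiplication by
      -- the proper `f` raises it to `suc n`.
      ≈⟨ K.+-congˡ (proper-*-congˡ-[] {f} f₀ (star≈powerSum f₀ n) w ≤-refl) ⟨
    1ˢ w +ᴷ (f * star f f₀) w ∎
    where n = length w

  ∂-star : ∀ a {f} (f₀ : f [] ≈ 0#) → ∂ a (star f f₀) ≋ ∂ a f * star f f₀
  ∂-star a f₀ w = K.trans (star-unfold f₀ (a ∷ w))
    (K.trans (K.+-identityˡ _) (zeroˡ-+ _ f₀))

  -- A contraction argument: if two solutions agree to order `n`, their products with the proper `p`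
  -- agree to order `suc n`, hence so do the solutions. Order zero is vacuous.
  proper-equation-unique : ∀ {p} → p [] ≈ 0# → ∀ {r g h} →
    g ≋ p * g + r → h ≋ p * h + r → g ≋ h
  proper-equation-unique {p} p₀ {r} {g} {h} g≋ h≋ w = agree (suc (length w)) w ≤-refl
    where
    agree : ∀ n → g ≈[ n ] h
    agree (suc n) w w<1+n = K.trans (g≋ w)
      (K.trans (K.+-congʳ (proper-*-congˡ-[] {p} p₀ (agree n) w w<1+n)) (K.sym (h≋ w)))

  -- By uniqueness it suffices that `star p p₀ * r` solves the equation, which is the unfolding of
  -- the star multiplied by `r`.
  arden : ∀ {p} (p₀ : p [] ≈ 0#) {r g} → g ≋ p * g + r → g ≋ star p p₀ * r
  arden {p} p₀ {r} g≋ = proper-equation-unique {p} p₀ g≋ (let open ≋-Reasoning in begin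
    p* * r                ≈⟨ S.*-congʳ {r} (star-unfold p₀) ⟩
    (1ˢ + p * p*) * r     ≈⟨ S.distribʳ r 1ˢ (p * p*) ⟩
    1ˢ * r + p * p* * r   ≈⟨ S.+-cong (S.*-identityˡ r) (S.*-assoc p p* r) ⟩
    r + p * (p* * r)      ≈⟨ S.+-comm r (p * (p* * r)) ⟩
    p * (p* * r) + r      ∎)
    where
    p* = star p p₀

  -- Rational series are recognizable

  ∂-isLeftLinear : ∀ a → IsLeftLinear (∂ a)
  ∂-isLeftLinear a = record
    { cong    = λ f≋g w → f≋g (a ∷ w)
    ; 0-homo  = λ w → K.refl
    ; +-homo  = λ f g w → K.refl
    ; *ₗ-homo = λ α f w → K.refl
    }

  ∂-LeftSpan : ∀ {n} {g : Vector Series n} → ∂-Stable g → ∀ a {f} → f ∈ LeftSpan g → ∂ a f ∈ LeftSpan g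
  ∂-LeftSpan stable a = LeftSpan-map (∂-isLeftLinear a) (LeftSpan-isLeftSubmodule _) (stable a)

  ∂-Stable-∷ : ∀ {n f} {g : Vector Series n} → ∂-Stable g → (∀ a → ∂ a f ∈ LeftSpan g) →
               ∂-Stable (f Vector.∷ g)
  ∂-Stable-∷ {f = f} {g} stable ∂f∈ a i = weaken {∂ a ((f Vector.∷ g) i)} (∂∈ i)
    where
    weaken : LeftSpan g ⊆ LeftSpan (f Vector.∷ g)
    weaken = LeftSpan-least (LeftSpan-isLeftSubmodule (f Vector.∷ g))
      (generator∈LeftSpan (f Vector.∷ g) ∘ suc)
    ∂∈ : ∀ i → ∂ a ((f Vector.∷ g) i) ∈ LeftSpan g
    ∂∈ zero    = ∂f∈ a
    ∂∈ (suc i) = stable a i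

  -- Prepending `f` to the family keeps it stable. This serves series whose derivatives lie in a
  -- known stable span while the series itself may not.
  ∂∈⇒recognizable : ∀ {n f} {g : Vector Series n} → ∂-Stable g → (∀ a → ∂ a f ∈ LeftSpan g) →
                    Recognizable f
  ∂∈⇒recognizable {f = f} {g} stable ∂f∈ =
    _ , f Vector.∷ g , ∂-Stable-∷ stable ∂f∈ , generator∈LeftSpan (f Vector.∷ g) zero

  ∂-1ˢ : ∀ a → ∂ a 1ˢ ∈ LeftSpan Vector.[]
  ∂-1ˢ a = (λ ()) , λ w → K.refl

  recognizable-1 : Recognizable 1ˢ
  recognizable-1 = ∂∈⇒recognizable {f = 1ˢ} {Vector.[]} (λ a ()) ∂-1ˢ

  ∂-letterSeries : ∀ α a → ∂ a (letterSeries α) ≋ α a *ₗ 1ˢ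
  ∂-letterSeries α a []      = K.sym (K.*-identityʳ (α a))
  ∂-letterSeries α a (_ ∷ _) = K.sym (K.zeroʳ (α a))

  -- Even for infinite `X`, all derivatives are multiples of the single series `1ˢ`, so one more
  -- generator suffices.
  recognizable-letterSeries : ∀ α → Recognizable (letterSeries α)
  recognizable-letterSeries α = let _ , g , stable , 1∈ = recognizable-1 in
    ∂∈⇒recognizable {g = g} stable λ a →
      let module N = IsLeftSubmodule (LeftSpan-isLeftSubmodule g)
      in N.resp (S.sym (∂-letterSeries α a)) (N.*ₗ-closed (α a) 1∈)

  module _ {m n} (g : Vector Series m) (h : Vector Series n) where

    LeftSpan-++ˡ : LeftSpan g ⊆ LeftSpan (g Vector.++ h)
    LeftSpan-++ˡ = LeftSpan-least (LeftSpan-isLeftSubmodule _) λ i →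
      ≡.subst (_∈ LeftSpan (g Vector.++ h)) (lookup-++ˡ g h i) (generator∈LeftSpan _ (i ↑ˡ n))

    LeftSpan-++ʳ : LeftSpan h ⊆ LeftSpan (g Vector.++ h)
    LeftSpan-++ʳ = LeftSpan-least (LeftSpan-isLeftSubmodule _) λ i →
      ≡.subst (_∈ LeftSpan (g Vector.++ h)) (lookup-++ʳ g h i) (generator∈LeftSpan _ (m ↑ʳ i))

    -- The hypotheses are asymmetric for the sake of products, where derivatives of the first block
    -- also have a component in the span of the second.
    ∂-Stable-++ : (∀ a i → ∂ a (g i) ∈ LeftSpan (g Vector.++ h)) → ∂-Stable h →
                  ∂-Stable (g Vector.++ h)
    ∂-Stable-++ g-stable h-stable a = All.++⁺ (λ f → ∂ a f ∈ LeftSpan (g Vector.++ h))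
      (g-stable a) (λ i → LeftSpan-++ʳ (h-stable a i))

  recognizable-+ : ∀ {f f′} → Recognizable f → Recognizable f′ → Recognizable (f + f′)
  recognizable-+ (_ , g , g-stable , f∈) (_ , h , h-stable , f′∈) =
    _ , g Vector.++ h ,
    ∂-Stable-++ g h (λ a i → LeftSpan-++ˡ g h (g-stable a i)) h-stable ,
    IsLeftSubmodule.+-closed (LeftSpan-isLeftSubmodule _) (LeftSpan-++ˡ g h f∈) (LeftSpan-++ʳ g h f′∈)

  LeftSpan-* : ∀ {n} {g : Vector Series n} h {f} → f ∈ LeftSpan g → f * h ∈ LeftSpan (λ i → g i * h)
  LeftSpan-* h = LeftSpan-map (*-isLeftLinear h) (LeftSpan-isLeftSubmodule _) (generator∈LeftSpan _)

  recognizable-* : ∀ {f f′} → Recognizable f → Recognizable f′ → Recognizable (f * f′)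
  recognizable-* {f′ = f′} (_ , g , g-stable , f∈) (_ , h , h-stable , f′∈) =
    _ , gf′ Vector.++ h , ∂-Stable-++ gf′ h ∂gf′∈ h-stable , LeftSpan-++ˡ gf′ h (LeftSpan-* f′ f∈)
    where
    gf′ : Vector Series _
    gf′ i = g i * f′
    module N = IsLeftSubmodule (LeftSpan-isLeftSubmodule (gf′ Vector.++ h))
    ∂gf′∈ : ∀ a i → ∂ a (gf′ i) ∈ LeftSpan (gf′ Vector.++ h)
    -- The Leibniz-type rule `∂ a (g i * f′) = g i [] *ₗ ∂ a f′ + ∂ a (g i) * f′` holds by
    -- computation, and its two terms fall into the two blocks.
    ∂gf′∈ a i = N.+-closed (N.*ₗ-closed (g i []) (LeftSpan-++ʳ gf′ h (∂-LeftSpan h-stable a f′∈)))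
                           (LeftSpan-++ˡ gf′ h (LeftSpan-* f′ (g-stable a i)))

  recognizable-*ᵣ : ∀ α {f} → Recognizable f → Recognizable (f *ᵣ α)
  recognizable-*ᵣ α (_ , g , stable , f∈) =
    _ , (λ i → g i *ᵣ α) , (λ a i → scale (stable a i)) , scale f∈
    where
    scale : ∀ {f} → f ∈ LeftSpan g → f *ᵣ α ∈ LeftSpan (λ i → g i *ᵣ α)
    scale = LeftSpan-map (*ᵣ-isLeftLinear α) (LeftSpan-isLeftSubmodule _) (generator∈LeftSpan _)

  -- The products `g i * f*` form a stable family: the product rule yields a multiple of `∂ a f*`,
  -- and `∂ a f*` equals `∂ a f * f*`, which lies in their span. The star itself, which has constant
  -- term one, is then prepended.
  recognizable-star : StarClosed Recognizable
  recognizable-star {f} (_ , g , stable , f∈) f₀ = ∂∈⇒recognizable {g = gf*} gf*-stable ∂f*∈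
    where
    f* = star f f₀
    gf* : Vector Series _
    gf* i = g i * f*
    module N = IsLeftSubmodule (LeftSpan-isLeftSubmodule gf*)
    ∂f*∈ : ∀ a → ∂ a f* ∈ LeftSpan gf*
    ∂f*∈ a = N.resp (S.sym (∂-star a f₀)) (LeftSpan-* f* (∂-LeftSpan stable a f∈))
    gf*-stable : ∂-Stable gf*
    gf*-stable a i = N.+-closed (N.*ₗ-closed (g i []) (∂f*∈ a)) (LeftSpan-* f* (stable a i))

  recognizable-isSubalgebra : IsSubalgebra Recognizable
  recognizable-isSubalgebra = record
    { resp      = λ f≋g (n , h , stable , f∈) →
        n , h , stable , IsLeftSubmodule.resp (LeftSpan-isLeftSubmodule h) f≋g f∈
    ; 0∈        = 0 , Vector.[] , (λ a ()) , IsLeftSubmodule.0∈ (LeftSpan-isLeftSubmodule Vector.[])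
    ; 1∈        = recognizable-1
    ; +-closed  = recognizable-+
    ; *-closed  = recognizable-*
    ; *ₗ-closed = λ α (n , h , stable , f∈) →
        n , h , stable , IsLeftSubmodule.*ₗ-closed (LeftSpan-isLeftSubmodule h) α f∈
    ; *ᵣ-closed = recognizable-*ᵣ
    }

  rational⇒recognizable : RationalClosure kX ⊆ Recognizable
  rational⇒recognizable = RationalClosure-least recognizable-isSubalgebra recognizable-star
    λ (α , f≋) → IsSubalgebra.resp recognizable-isSubalgebra (S.sym f≋) (recognizable-letterSeries α)


  -- Recognizable series are rational

  module _ {p} {G : Pred Series p} where

    private
      R : Pred Series _
      R = RationalClosure G

    sumˢ-rational : ∀ {n} {F : Vector Series n} → (∀ i → F i ∈ R) → S.sum F ∈ R
    sumˢ-rational {zero}  F∈R = zeroᴿ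
    sumˢ-rational {suc n} F∈R = add (F∈R zero) (sumˢ-rational (F∈R ∘ suc))

    -- Induction on the number of unknowns. Arden's lemma expresses `g zero` through the other
    -- unknowns, and substitution leaves a proper system with one unknown fewer. The solution `g` is
    -- given in advance; only its rationality is at stake.
    properSystem⇒rational : ∀ {n} (P : Fin n → Fin n → Series) (r g : Vector Series n) →
      (∀ i j → P i j ∈ R) → (∀ i j → P i j [] ≈ 0#) → (∀ i → r i ∈ R) →
      (∀ i → g i ≋ S.sum (λ j → P i j * g j) + r i) → ∀ i → g i ∈ R
    properSystem⇒rational {suc n} P r g P∈R P₀ r∈R g≋ = λ
      { zero    → resp (S.sym g₀≋) (mul p*∈R (add
                    (sumˢ-rational λ j → mul (P∈R zero (suc j)) (g∈R j)) (r∈R zero)))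
      ; (suc i) → g∈R i
      }
      where
      p* = star (P zero zero) (P₀ zero zero)
      p*∈R : p* ∈ R
      p*∈R = starᴿ (P∈R zero zero) (P₀ zero zero)

      B = S.sum (λ j → P zero (suc j) * g (suc j))

      g₀≋ : g zero ≋ p* * (B + r zero)
      g₀≋ = arden (P₀ zero zero) (S.trans (g≋ zero) (S.+-assoc (P zero zero * g zero) B (r zero)))

      -- `Q i` is the factor by which `B + r zero` enters equation `suc i` once `g zero` has been
      -- replaced.
      Q r′ : Vector Series n
      Q i  = P (suc i) zero * p*
      r′ i = r (suc i) + Q i * r zero
      Q∈R : ∀ i → Q i ∈ R
      Q∈R i = mul (P∈R (suc i) zero) p*∈R

      P′ : Fin n → Fin n → Series
      P′ i j = P (suc i) (suc j) + Q i * P zero (suc j)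

      -- The new coefficients stay proper: at the empty word the product has a single summand, whose
      -- right factor `P zero (suc j) []` vanishes.
      P′₀ : ∀ i j → P′ i j [] ≈ 0#
      P′₀ i j = let open ≈-Reasoning in begin
        P (suc i) (suc j) [] +ᴷ (Q i [] *ᴷ P zero (suc j) [] +ᴷ 0#)
          ≈⟨ K.+-cong (P₀ (suc i) (suc j)) (K.+-identityʳ _) ⟩
        0# +ᴷ Q i [] *ᴷ P zero (suc j) []
          ≈⟨ K.+-identityˡ _ ⟩
        Q i [] *ᴷ P zero (suc j) []
          ≈⟨ K.trans (K.*-congˡ (P₀ zero (suc j))) (K.zeroʳ _) ⟩
        0# ∎

      substituted : ∀ i → g (suc i) ≋ S.sum (λ j → P′ i j * g (suc j)) + r′ i
      substituted i = let open ≋-Reasoning in begin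
        g (suc i)
          ≈⟨ g≋ (suc i) ⟩
        P (suc i) zero * g zero + A + r (suc i)
          ≈⟨ S.+-congʳ {r (suc i)} (S.+-congʳ {A} Pg₀≋) ⟩
        Q i * B + Q i * r zero + A + r (suc i)
          ≈⟨ solve 4 (λ a b c d → ((a ⊕ b) ⊕ c) ⊕ d ⊜ (c ⊕ a) ⊕ (d ⊕ b)) S.refl
               (Q i * B) (Q i * r zero) A (r (suc i)) ⟩
        A + Q i * B + r′ i
          ≈⟨ S.+-congʳ {r′ i} A+QB≋ ⟩
        S.sum (λ j → P′ i j * g (suc j)) + r′ i ∎
        where
        open CommutativeMonoidSolver S.+-commutativeMonoid using (solve; _⊕_; _⊜_)
        A = S.sum (λ j → P (suc i) (suc j) * g (suc j))
        Pg₀≋ : P (suc i) zero * g zero ≋ Q i * B + Q i * r zero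
        Pg₀≋ = let open ≋-Reasoning in begin
          P (suc i) zero * g zero               ≈⟨ S.*-congˡ {P (suc i) zero} g₀≋ ⟩
          P (suc i) zero * (p* * (B + r zero))  ≈⟨ S.*-assoc (P (suc i) zero) p* (B + r zero) ⟨
          Q i * (B + r zero)                    ≈⟨ S.distribˡ (Q i) B (r zero) ⟩
          Q i * B + Q i * r zero                ∎
        A+QB≋ : A + Q i * B ≋ S.sum (λ j → P′ i j * g (suc j))
        A+QB≋ = let open ≋-Reasoning in begin
          A + Q i * B
            ≈⟨ S.+-congˡ {A} (S.*-distribˡ-sum (Q i) (λ j → P zero (suc j) * g (suc j))) ⟩
          A + S.sum (λ j → Q i * (P zero (suc j) * g (suc j)))
            ≈⟨ S.∑-distrib-+ (λ j → P (suc i) (suc j) * g (suc j)) _ ⟨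
          S.sum (λ j → P (suc i) (suc j) * g (suc j) + Q i * (P zero (suc j) * g (suc j)))
            ≈⟨ S.sum-cong-≋ (λ j → S.+-congˡ {P (suc i) (suc j) * g (suc j)}
                 (S.*-assoc (Q i) (P zero (suc j)) (g (suc j)))) ⟨
          S.sum (λ j → P (suc i) (suc j) * g (suc j) + Q i * P zero (suc j) * g (suc j))
            ≈⟨ S.sum-cong-≋ (λ j → S.distribʳ (g (suc j)) (P (suc i) (suc j)) (Q i * P zero (suc j))) ⟨
          S.sum (λ j → P′ i j * g (suc j)) ∎

      g∈R : ∀ j → g (suc j) ∈ R
      g∈R = properSystem⇒rational P′ r′ (g ∘ suc)
        (λ i j → add (P∈R (suc i) (suc j)) (mul (Q∈R i) (P∈R zero (suc j)))) P′₀
        (λ i → add (r∈R (suc i)) (mul (Q∈R i) (r∈R zero))) substituted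

  -- Only the factorisation that cuts just after the first letter contributes.
  letterSeries-*-∷ : ∀ α h a w → (letterSeries α * h) (a ∷ w) ≈ α a *ᴷ h w
  letterSeries-*-∷ α h a w = let open ≈-Reasoning in begin
    0# *ᴷ h (a ∷ w) +ᴷ (∂ a (letterSeries α) * h) w  ≈⟨ zeroˡ-+ _ K.refl ⟩
    (∂ a (letterSeries α) * h) w                     ≈⟨ *-cong (∂-letterSeries α a) (S.refl {h}) w ⟩
    ((α a *ₗ 1ˢ) * h) w                              ≈⟨ *ₗ-*-assoc (α a) 1ˢ h w ⟩
    α a *ᴷ (1ˢ * h) w                                ≈⟨ K.*-congˡ (*-identityˡ h w) ⟩
    α a *ᴷ h w                                       ∎

  -- The rational closure is a left submodule, so it is enough that it contains the generators.
  -- These solve a system with coefficients in `kX`, proper because a `letterSeries` vanishes at the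
  -- empty word.
  recognizable⇒rational : Recognizable ⊆ RationalClosure kX
  recognizable⇒rational (n , g , stable , f∈) = LeftSpan-least
    (record { resp = resp ; 0∈ = zeroᴿ ; +-closed = add ; *ₗ-closed = scaleₗ })
    (properSystem⇒rational P r g (λ i j → gen (_ , S.refl)) (λ i j → K.refl)
      (λ i → scaleₗ (g i []) oneᴿ) g≋)
    f∈
    where
    P : Fin n → Fin n → Series
    P i j = letterSeries (λ a → proj₁ (stable a i) j)
    r : Vector Series n
    r i = g i [] *ₗ 1ˢ
    g≋ : ∀ i → g i ≋ S.sum (λ j → P i j * g j) + r i
    g≋ i [] = let open ≈-Reasoning in begin
      g i []                                            ≈⟨ K.*-identityʳ _ ⟨
      r i []                                            ≈⟨ K.+-identityˡ _ ⟨
      0# +ᴷ r i []                                      ≈⟨ K.+-congʳ (sum-zero {n} λ j → zeroˡ-+ (g j []) K.refl) ⟨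
      sum (λ j → (P i j * g j) []) +ᴷ r i []            ≡⟨ ≡.cong (_+ᴷ r i []) (sumˢ-lookup (λ j → P i j * g j) []) ⟨
      S.sum (λ j → P i j * g j) [] +ᴷ r i []            ∎
    g≋ i (a ∷ w) = let open ≈-Reasoning in begin
      g i (a ∷ w)
        ≈⟨ proj₂ (stable a i) w ⟩
      sum (λ j → proj₁ (stable a i) j *ᴷ g j w)
        ≈⟨ sum-cong-≋ (λ j → letterSeries-*-∷ (λ a → proj₁ (stable a i) j) (g j) a w) ⟨
      sum (λ j → (P i j * g j) (a ∷ w))
        ≡⟨ sumˢ-lookup (λ j → P i j * g j) (a ∷ w) ⟨
      S.sum (λ j → P i j * g j) (a ∷ w)
        ≈⟨ K.trans (K.+-congˡ (K.zeroʳ _)) (K.+-identityʳ _) ⟨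
      S.sum (λ j → P i j * g j) (a ∷ w) +ᴷ r i (a ∷ w) ∎

theorem4p5 : ∀ {c ℓ x} (K : Semiring c ℓ) (X : Set x) (f : List X → Semiring.Carrier K) →
    let open FormalSeries K X in
    (RightShiftsInFGLeftSubmodule f ⇔ LeftShiftsInFGRightSubmodule f)
    × (LeftShiftsInFGRightSubmodule f ⇔ HasLinearRepresentation f)
    × (HasLinearRepresentation f ⇔ f ∈ RationalClosure kX)
theorem4p5 K X f = ⇔-trans i⇔iii (⇔-sym ii⇔iii) , ii⇔iii , iii⇔iv
  where
  open FormalSeries K X
  i⇔iii : RightShiftsInFGLeftSubmodule f ⇔ HasLinearRepresentation f
  i⇔iii = mk⇔ (recognizable⇒representation K X ∘ rightShifts⇒recognizable K X)
              (representation⇒rightShifts K X)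
  ii⇔iii : LeftShiftsInFGRightSubmodule f ⇔ HasLinearRepresentation f
  ii⇔iii = mk⇔ (leftShifts⇒representation K X) (representation⇒leftShifts K X)
  iii⇔iv : HasLinearRepresentation f ⇔ f ∈ RationalClosure kX
  -- The detour through (i) turns a morphism on words into a family stable under letters, from which
  -- the linear system is read.
  iii⇔iv = mk⇔ (recognizable⇒rational K X ∘ rightShifts⇒recognizable K X ∘ representation⇒rightShifts K X)
               (recognizable⇒representation K X ∘ rational⇒recognizable K X)
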